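{- Let $C$ be a positive integer. If $H$ is an oriented graph on $N\ge21C-12$ vertices with $\delta^0(H)\ge\frac N3-C+1$, then for every ordered pair $(x,y)$ of distinct vertices of $H$ there is a directed path from $x$ to $y$ in $H$ of length $3$, $4$, or $5$.
   Context: An oriented graph is an orientation of a (finite) simple graph: no loops, and at most one arc on each unordered pair of vertices. $\delta^0(H)=\min_{v}\min\{d^+(v),d^-(v)\}$ is the minimum semidegree. Paths are directed and simple (no repeated vertices), and the length is the number of arcs. -}

module Defs where

open import Data.Fin.Base using (Fin)
open import Data.Fin.Subset using (Subset; ∣_∣)
open import Data.Integer.Base using (+_)
open import Data.Nat.Base using (ℕ; suc; _⊓_)
open import Data.Rational.Unnormalised.Base using (ℚᵘ; _/_)
open import Data.Vec.Base using (Vec; head; last; tabulate)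
import Data.Vec.Functional as Vector
open import Data.Vec.Relation.Unary.Linked using (Linked)
open import Data.Vec.Relation.Unary.Unique.Propositional using (Unique)
open import Level using (0ℓ)
open import Relation.Binary.Core using (Rel)
open import Relation.Binary.Definitions using (Asymmetric; Decidable; Irreflexive)
open import Relation.Binary.PropositionalEquality.Core using (_≡_)
open import Relation.Nullary.Decidable.Core using (does)

-- Decidability of the arc relation is part of what it means for the graph to
-- be finite; it is what makes degrees computable.
record OrientedGraph (N : ℕ) : Set₁ where
  field
    Arc    : Rel (Fin N) 0ℓ
    arc?   : Decidable Arc
    irrefl : Irreflexive _≡_ Arc
    asym   : Asymmetric Arc

module _ {N : ℕ} (H : OrientedGraph N) where
  open OrientedGraph H

  N⁺ N⁻ : Fin N → Subset N
  N⁺ v = tabulate λ w → does (arc? v w)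
  N⁻ v = tabulate λ w → does (arc? w v)

  d⁺ d⁻ : Fin N → ℕ
  d⁺ v = ∣ N⁺ v ∣
  d⁻ v = ∣ N⁻ v ∣

  -- Every degree is at most N, so starting the fold at N does not affect the
  -- minimum when there is at least one vertex.
  δ⁰ : ℕ
  δ⁰ = Vector.foldr _⊓_ N λ v → d⁺ v ⊓ d⁻ v

  -- A directed path from x to y with k arcs, hence k + 1 distinct vertices.
  record Path (x y : Fin N) (k : ℕ) : Set where
    field
      vertices : Vec (Fin N) (suc k)
      starts   : head vertices ≡ x
      ends     : last vertices ≡ y
      arcs     : Linked Arc vertices
      simple   : Unique vertices

fromℕ : ℕ → ℚᵘ
fromℕ n = + n / 1

{-# OPTIONS --safe #-}

-- Eliminating C, the hypotheses say that d = δ⁰(H) satisfies 7d ≥ 2N + 3 and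
-- d ≥ 3. Suppose there is no path of length 3, 4 or 5. Put A = N⁺(x) ∖ {y},
-- B = N⁻(y) ∖ {x}, and choose distinct a ∈ A and b ∈ B. Let P be the set of
-- vertices outside A ∪ {y} with an in-neighbour in (A ∖ B) ∪ {a}, and Q the
-- set obtained in the same way from B, b and x in the reversed graph. Then
-- A ∖ B, P, B ∖ A, Q and A ∩ B are pairwise disjoint, arcs from A ∖ B end in
-- X = (A ∖ B) ∪ P, and arcs from P end in X or in the set U of vertices other
-- than y outside A ∪ B ∪ P ∪ Q. Counting the arcs leaving A ∖ B and X, of which
-- at most |S|(|S| - 1)/2 lie inside a set S, bounds |P| from below and |X| in
-- terms of |P| |U|. These bounds and their mirror images contradict
-- |A ∖ B| + |P| + |B ∖ A| + |Q| + |A ∩ B| + |U| + 1 ≤ N.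
module Submission where

open import Defs
open import Algebra.Properties.Semiring.Sum as SemiringSum using ()
open import Data.Bool.Base using (true; false; if_then_else_)
open import Data.Empty using (⊥; ⊥-elim)
open import Data.Fin.Base using (Fin; zero; suc)
open import Data.Fin.Properties using (any?; _≟_)
open import Data.Fin.Subset using (∣_∣)
import Data.Integer.Base as ℤ
import Data.Integer.Properties as ℤₚ
import Data.Integer.Tactic.RingSolver as ℤRing
open import Data.List.Base using ([]; _∷_)
open import Data.Nat.Base as Nat
  using (ℕ; zero; suc; _*_; _∸_; _≤_; _<_; _≥_; _⊓_; z≤n; s≤s; NonZero)
open import Data.Nat.Properties hiding (_≟_)
open import Data.Nat.Tactic.RingSolver using (solve; solve-∀)
open import Data.Product.Base using (_×_; _,_; ∃-syntax; proj₁; swap)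
open import Data.Sum.Base as Sum using (_⊎_; inj₁; inj₂; [_,_])
open import Data.Vec.Base using (tabulate)
import Data.Vec.Functional as Vector
open import Function.Base using (_∘_; flip; id)
open import Level using (0ℓ)
import Relation.Binary as Rel
open import Relation.Binary.PropositionalEquality
  using (_≡_; _≢_; refl; sym; trans; cong; cong₂; subst)
open import Relation.Nullary using (¬_; Dec; yes; no; does)
open import Relation.Nullary.Decidable using (_×-dec_; _⊎-dec_; ¬?)
open import Relation.Unary using (Pred; Decidable; _∪_; _∩_; ∁)
open import Relation.Unary.Properties using (_∪?_; _∩?_; ∁?)

-- Cardinalities and arc counts as sums of indicators

module Counting where
  open Nat using (_+_)
  open SemiringSum +-*-semiring
    using (sum; ∑-distrib-+; ∑-comm; *-distribˡ-sum; *-distribʳ-sum; sum-cong-≗)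

  private variable
    n : ℕ
    P Q : Pred (Fin n) 0ℓ

  sum-mono : {f g : Fin n → ℕ} → (∀ i → f i ≤ g i) → sum f ≤ sum g
  sum-mono {zero}  f≤g = z≤n
  sum-mono {suc n} f≤g = +-mono-≤ (f≤g zero) (sum-mono (f≤g ∘ suc))

  sum-≤ : {f : Fin n → ℕ} → (∀ i → f i ≤ 1) → sum f ≤ n
  sum-≤ {zero}  f≤1 = z≤n
  sum-≤ {suc n} f≤1 = +-mono-≤ (f≤1 zero) (sum-≤ (f≤1 ∘ suc))

  𝟙 : {X : Set} → Dec X → ℕ
  𝟙 X? = if does X? then 1 else 0

  𝟙≤1 : {X : Set} (X? : Dec X) → 𝟙 X? ≤ 1
  𝟙≤1 (yes _) = ≤-refl
  𝟙≤1 (no _)  = z≤n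

  𝟙-mono : {X Y : Set} (X? : Dec X) (Y? : Dec Y) → (X → Y) → 𝟙 X? ≤ 𝟙 Y?
  𝟙-mono (no _)  _       _ = z≤n
  𝟙-mono (yes _) (yes _) _ = ≤-refl
  𝟙-mono (yes x) (no ¬y) f = ⊥-elim (¬y (f x))

  -- Cardinality is a sum of indicators so that double counting becomes interchange and
  -- distributivity of finite sums.
  # : {P : Pred (Fin n) 0ℓ} → Decidable P → ℕ
  # P? = sum λ i → 𝟙 (P? i)

  #-mono : (P? : Decidable P) (Q? : Decidable Q) → (∀ {i} → P i → Q i) → # P? ≤ # Q?
  #-mono P? Q? P⊆Q = sum-mono λ i → 𝟙-mono (P? i) (Q? i) P⊆Q

  #≤n : {P : Pred (Fin n) 0ℓ} (P? : Decidable P) → # P? ≤ n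
  #≤n P? = sum-≤ λ i → 𝟙≤1 (P? i)

  #-∪-≤ : (P? : Decidable P) (Q? : Decidable Q) → # (P? ∪? Q?) ≤ # P? + # Q?
  #-∪-≤ P? Q? = ≤-trans (sum-mono λ i → go (P? i) (Q? i))
    (≤-reflexive (∑-distrib-+ (𝟙 ∘ P?) (𝟙 ∘ Q?)))
    where
    go : {X Y : Set} (X? : Dec X) (Y? : Dec Y) → 𝟙 (X? ⊎-dec Y?) ≤ 𝟙 X? + 𝟙 Y?
    go (yes _) _       = s≤s z≤n
    go (no _)  (yes _) = ≤-refl
    go (no _)  (no _)  = z≤n

  #-disjoint : (P? : Decidable P) (Q? : Decidable Q) → (∀ {i} → P i → Q i → ⊥) →
    # P? + # Q? ≤ # (P? ∪? Q?)
  #-disjoint P? Q? disj = ≤-trans (≤-reflexive (sym (∑-distrib-+ (𝟙 ∘ P?) (𝟙 ∘ Q?))))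
    (sum-mono λ i → go (P? i) (Q? i) disj)
    where
    go : {X Y : Set} (X? : Dec X) (Y? : Dec Y) → (X → Y → ⊥) → 𝟙 X? + 𝟙 Y? ≤ 𝟙 (X? ⊎-dec Y?)
    go (yes x) (yes y) d = ⊥-elim (d x y)
    go (yes _) (no _)  _ = ≤-refl
    go (no _)  (yes _) _ = ≤-refl
    go (no _)  (no _)  _ = z≤n

  #-empty : {P : Pred (Fin n) 0ℓ} (P? : Decidable P) → (∀ {i} → ¬ P i) → # P? ≡ 0
  #-empty {n = n} P? ¬P = n≤0⇒n≡0 (≤-trans (sum-mono {g = λ _ → 0} λ i → 𝟙-mono (P? i) (no id) ¬P)
    (≤-reflexive (zeros n)))
    where
    zeros : ∀ n → sum {n} (λ _ → 0) ≡ 0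
    zeros zero    = refl
    zeros (suc n) = zeros n

  #-singleton : (i : Fin n) → # (_≟ i) ≡ 1
  #-singleton {suc n} zero = cong suc (#-empty {n} (λ j → suc j ≟ zero) λ ())
  #-singleton (suc i)      = trans (sum-cong-≗ λ j → go j) (#-singleton i)
    where
    go : ∀ j → 𝟙 (suc j ≟ suc i) ≡ 𝟙 (j ≟ i)
    go j with j ≟ i
    ... | yes _ = refl
    ... | no _  = refl

  -- Otherwise `P` would be contained in a set of at most two elements. This supplies the vertices
  -- `a` and `b`; `u` and `v` may coincide.
  #-avoid : (P? : Decidable P) → 3 ≤ # P? → ∀ u v → ∃[ w ] P w × w ≢ u × w ≢ v
  #-avoid P? 3≤ u v with any? (λ w → P? w ×-dec ¬? (w ≟ u) ×-dec ¬? (w ≟ v))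
  ... | yes found = found
  ... | no none   = ⊥-elim (<⇒≱ 3≤ (begin
    # P?                     ≤⟨ #-mono P? ((_≟ u) ∪? (_≟ v)) (λ {w} → near w) ⟩
    # ((_≟ u) ∪? (_≟ v))     ≤⟨ #-∪-≤ (_≟ u) (_≟ v) ⟩
    # (_≟ u) + # (_≟ v)      ≡⟨ cong₂ _+_ (#-singleton u) (#-singleton v) ⟩
    2                        ∎))
    where
    open ≤-Reasoning
    near : ∀ w → _ → w ≡ u ⊎ w ≡ v
    near w Pw with w ≟ u | w ≟ v
    ... | yes w≡u | _       = inj₁ w≡u
    ... | no _    | yes w≡v = inj₂ w≡v
    ... | no w≢u  | no w≢v  = ⊥-elim (none (w , Pw , w≢u , w≢v))

  ∑∑ : (Fin n → Fin n → ℕ) → ℕ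
  ∑∑ f = sum λ v → sum (f v)

  ∑∑-+ : (f g : Fin n → Fin n → ℕ) → ∑∑ (λ v w → f v w + g v w) ≡ ∑∑ f + ∑∑ g
  ∑∑-+ f g = trans (sum-cong-≗ λ v → ∑-distrib-+ (f v) (g v))
    (∑-distrib-+ (λ v → sum (f v)) (λ v → sum (g v)))

  ∑∑-* : (f g : Fin n → ℕ) → ∑∑ (λ v w → f v * g w) ≡ sum f * sum g
  ∑∑-* f g = trans (sum-cong-≗ λ v → sym (*-distribˡ-sum (f v) g)) (sym (*-distribʳ-sum (sum g) f))

  module _ {E : Rel.Rel (Fin n) 0ℓ} (E? : Rel.Decidable E) (asym : Rel.Asymmetric E) where

    -- Each ordered pair (v , w) of vertices in S accounts for at most one of an
    -- arc v → w, an arc w → v and the equality v ≡ w.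
    arcs-leaving :
      {S T U : Pred (Fin n) 0ℓ} (S? : Decidable S) (T? : Decidable T) (U? : Decidable U) →
      (∀ {v w} → S v → E v w → S w ⊎ T v × U w) →
      ∀ d → (∀ v → d ≤ # (E? v)) →
      2 * (d * # S?) + # S? ≤ # S? * # S? + 2 * (# T? * # U?)
    arcs-leaving {S} {T} {U} S? T? U? land d deg = begin
      -- Doubling makes the count symmetric in `v` and `w`, so that both sides can be compared pair
      -- by pair. The extra `# S?` is the diagonal: it turns the square of `# S?` into the bound
      -- |S|(|S| - 1)/2 on arcs inside S.
      2 * (d * # S?) + # S?
        ≤⟨ +-monoˡ-≤ (# S?) (*-monoʳ-≤ 2 outdegrees) ⟩
      2 * ∑∑ out + # S?
        ≡⟨ cong₂ _+_ (twice out) diagonal ⟩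
      ∑∑ out + ∑∑ (flip out) + ∑∑ diag
        ≡⟨ trans (cong (_+ ∑∑ diag) (sym (∑∑-+ out (flip out))))
             (sym (∑∑-+ (λ v w → out v w + out w v) diag)) ⟩
      ∑∑ (λ v w → out v w + out w v + diag v w)
        ≤⟨ sum-mono (λ v → sum-mono (pointwise v)) ⟩
      ∑∑ (λ v w → ss v w + (tu v w + tu w v))
        ≡⟨ trans (∑∑-+ ss _) (cong₂ _+_ (∑∑-* s s) (∑∑-+ tu (flip tu))) ⟩
      # S? * # S? + (∑∑ tu + ∑∑ (flip tu))
        ≡⟨ cong (# S? * # S? +_) (trans (sym (twice tu)) (cong (2 *_) (∑∑-* t u))) ⟩
      # S? * # S? + 2 * (# T? * # U?) ∎
      where
      open ≤-Reasoning
      s t u : Fin n → ℕ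
      s v = 𝟙 (S? v)
      t v = 𝟙 (T? v)
      u v = 𝟙 (U? v)

      out diag ss tu : Fin n → Fin n → ℕ
      out v w  = s v * 𝟙 (E? v w)
      diag v w = s v * 𝟙 (w ≟ v)
      ss v w   = s v * s w
      tu v w   = t v * u w

      outdegrees : d * # S? ≤ ∑∑ out
      outdegrees = begin
        d * # S?                           ≡⟨ *-distribˡ-sum d s ⟩
        sum (λ v → d * s v)                ≤⟨ sum-mono (λ v → begin
          d * s v                            ≤⟨ *-monoˡ-≤ (s v) (deg v) ⟩
          # (E? v) * s v                     ≡⟨ *-comm (# (E? v)) (s v) ⟩
          s v * # (E? v)                     ≡⟨ *-distribˡ-sum (s v) (λ w → 𝟙 (E? v w)) ⟩
          sum (out v)                        ∎) ⟩
        ∑∑ out                             ∎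

      twice : (f : Fin n → Fin n → ℕ) → 2 * ∑∑ f ≡ ∑∑ f + ∑∑ (flip f)
      twice f = cong (∑∑ f +_) (trans (+-identityʳ _) (∑-comm f))

      diagonal : # S? ≡ ∑∑ diag
      diagonal = sum-cong-≗ λ v → trans (sym (*-identityʳ (s v)))
        (trans (cong (s v *_) (sym (#-singleton v))) (*-distribˡ-sum (s v) (λ w → 𝟙 (w ≟ v))))

      pointwise : ∀ v w → out v w + out w v + diag v w ≤ s v * s w + (t v * u w + t w * u v)
      pointwise v w with w ≟ v
      pointwise v v | yes refl with S? v | E? v v
      ... | _     | yes e = ⊥-elim (asym e e)
      ... | yes _ | no _  = s≤s z≤n
      ... | no _  | no _  = z≤n
      pointwise v w | no _ with S? v | S? w | E? v w | E? w v
      ... | _ | _ | yes e | yes e′ = ⊥-elim (asym e e′)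
      ... | no _  | no _  | _ | _ = z≤n
      ... | yes _ | yes _ | yes _ | no _ = s≤s z≤n
      ... | yes _ | yes _ | no _ | yes _ = s≤s z≤n
      ... | yes _ | yes _ | no _ | no _ = z≤n
      ... | yes _ | no _  | no _ | _ = z≤n
      ... | no _  | yes _ | _ | no _ = z≤n
      -- The arc leaves `S`, so `land` charges it to a pair in `T` times `U`; the next group treats
      -- the same situation with `v` and `w` exchanged.
      ... | yes sv | no ¬sw | yes e | no _ with land sv e
      ...   | inj₁ sw = ⊥-elim (¬sw sw)
      ...   | inj₂ (tv , uw) with T? v | U? w
      ...     | yes _ | yes _ = s≤s z≤n
      ...     | no ¬t | _     = ⊥-elim (¬t tv)
      ...     | yes _ | no ¬u = ⊥-elim (¬u uw)
      pointwise v w | no _ | no ¬sv | yes sw | no _ | yes e with land sw e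
      ...   | inj₁ sv = ⊥-elim (¬sv sv)
      ...   | inj₂ (tw , uv) with T? w | U? v
      ...     | yes _ | yes _ = m≤n+m 1 (t v * u w)
      ...     | no ¬t | _     = ⊥-elim (¬t tw)
      ...     | yes _ | no ¬u = ⊥-elim (¬u uv)

-- Contradictory inequalities between the cardinalities

module Arithmetic where
  open Nat using (_+_)

  infixr 4 _⊞_
  infix 5 _⊠_

  _⊞_ : ∀ {i j m n} → i ≤ j → m ≤ n → i + m ≤ j + n
  _⊞_ = +-mono-≤

  _⊠_ : ∀ c {m n} → m ≤ n → c * m ≤ c * n
  _⊠_ = *-monoʳ-≤

  -- Closes a certificate: `m ≤ n` is the combined inequality, and a ring identity exhibits the
  -- positive excess `suc c` of `m` over `n`.
  overshoot : ∀ {c m n} → m ≡ n + suc c → m ≤ n → ⊥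
  overshoot {n = n} refl n+sc≤n = <⇒≱ (m<m+n n Nat.z<s) n+sc≤n

  -- Throughout, α = |A ∖ B|, p = |P|, β = |B ∖ A|, q = |Q|,
  -- k = |A ∩ B| and r = |U|.
  Small Large : (d α p r : ℕ) → Set
  Small d α p r = 2 * d + 1 ≤ α + p + r
  Large d α p r = 4 * d ≤ 3 * p + 2 * r + α + 1

  module _ {d α p r : ℕ} (d≥3 : 3 ≤ d) (p-large : 2 * d ≤ 2 * p + α + 2)
    (arcs : 2 * (d * (α + p)) + (α + p) ≤ (α + p) * (α + p) + 2 * (p * r)) where

    -- Here `2p ≤ α + p`, so every term of `arcs` is bounded by a multiple of `α + p`, which can be
    -- cancelled.
    small : p ≤ α → Small d α p r
    small p≤α = *-cancelʳ-≤ (2 * d + 1) (α + p + r) (α + p) {{nonZero}} (begin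
      (2 * d + 1) * (α + p)              ≡⟨ solve (d ∷ α ∷ p ∷ []) ⟩
      2 * (d * (α + p)) + (α + p)        ≤⟨ arcs ⟩
      (α + p) * (α + p) + 2 * (p * r)    ≡⟨ solve (r ∷ α ∷ p ∷ []) ⟩
      (α + p) * (α + p) + (p + p) * r    ≤⟨ +-monoʳ-≤ ((α + p) * (α + p)) (*-monoˡ-≤ r (+-monoˡ-≤ p p≤α)) ⟩
      (α + p) * (α + p) + (α + p) * r    ≡⟨ solve (r ∷ α ∷ p ∷ []) ⟩
      (α + p + r) * (α + p)              ∎)
      where
      open ≤-Reasoning
      -- If `α + p` vanished, `p-large` would read `2d ≤ 2`, against `d ≥ 3`.
      nonZero : NonZero (α + p)
      nonZero = Nat.≢-nonZero λ α+p≡0 → overshoot {α + 3} identity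
        (2 ⊠ d≥3 ⊞ p-large ⊞ 2 ⊠ ≤-reflexive α+p≡0)
        where
        identity : 2 * 3 + (2 * d + 2 * (α + p)) ≡ 2 * d + (2 * p + α + 2 + 2 * 0) + suc (α + 3)
        identity = solve (d ∷ α ∷ p ∷ [])

    -- Adding `p - α ≥ 0` times `p-large` to `arcs` raises the coefficient of `d` to `4p`; dropping
    -- `3α` then leaves a common factor `p`. In the code `t` is `p - α` and `s` is the slack of
    -- `p-large`.
    large : α ≤ p → Large d α p r
    large α≤p with m≤n⇒∃[o]m+o≡n α≤p | m≤n⇒∃[o]m+o≡n p-large
    ... | t , α+t≡p | s , 2d+s≡2p+α+2 = *-cancelʳ-≤ (4 * d) (3 * p + 2 * r + α + 1) p {{nonZero}}
      (+-cancelʳ-≤ K _ _ (begin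
        4 * d * p + K
          ≤⟨ m≤m+n _ (3 * α + s * t) ⟩
        4 * d * p + K + (3 * α + s * t)
          ≡⟨ cong (λ z → 4 * d * z + (2 * (d * α) + 2 * (α * z) + α * α + z + s * α) + (3 * α + s * t)) (sym α+t≡p) ⟩
        4 * d * (α + t) + (2 * (d * α) + 2 * (α * (α + t)) + α * α + (α + t) + s * α) + (3 * α + s * t)
          ≡⟨ solve (d ∷ α ∷ t ∷ s ∷ []) ⟩
        (2 * (d * (α + (α + t))) + (α + (α + t))) + ((α + t) * (2 * d + s) + α * (2 * (α + t) + α + 2))
          ≡⟨ cong (λ z → (2 * (d * (α + z)) + (α + z)) + (z * (2 * d + s) + α * (2 * z + α + 2))) α+t≡p ⟩
        (2 * (d * (α + p)) + (α + p)) + (p * (2 * d + s) + α * (2 * p + α + 2))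
          ≤⟨ +-monoˡ-≤ _ arcs ⟩
        ((α + p) * (α + p) + 2 * (p * r)) + (p * (2 * d + s) + α * (2 * p + α + 2))
          ≡⟨ cong (((α + p) * (α + p) + 2 * (p * r)) +_)
               (cong₂ _+_ (cong (p *_) 2d+s≡2p+α+2) (cong (α *_) (sym 2d+s≡2p+α+2))) ⟩
        ((α + p) * (α + p) + 2 * (p * r)) + (p * (2 * p + α + 2) + α * (2 * d + s))
          ≡⟨ solve (d ∷ α ∷ p ∷ r ∷ s ∷ []) ⟩
        (3 * p + 2 * r + α + 1) * p + (2 * (d * α) + 2 * (α * p) + α * α + p + s * α) ∎))
      where
      open ≤-Reasoning
      -- To avoid subtracting `α` times `p-large`, its sides are added crosswise; `K` is the
      -- resulting surplus common to both sides.
      K = 2 * (d * α) + 2 * (α * p) + α * α + p + s * α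
      nonZero : NonZero p
      nonZero = Nat.≢-nonZero λ p≡0 → overshoot {3} identity
        (2 ⊠ d≥3 ⊞ p-large ⊞ α≤p ⊞ 3 ⊠ ≤-reflexive p≡0)
        where
        identity : 2 * 3 + (2 * d + (α + 3 * p)) ≡ 2 * d + (2 * p + α + 2 + (p + 3 * 0)) + suc 3
        identity = solve (d ∷ α ∷ p ∷ [])

  dichotomy : {d α p r : ℕ} → 3 ≤ d → 2 * d ≤ 2 * p + α + 2 →
    2 * (d * (α + p)) + (α + p) ≤ (α + p) * (α + p) + 2 * (p * r) →
    Small d α p r ⊎ Large d α p r
  dichotomy {α = α} {p} d≥3 p-large arcs with ≤-total p α
  ... | inj₁ p≤α = inj₁ (small d≥3 p-large arcs p≤α)
  ... | inj₂ α≤p = inj₂ (large d≥3 p-large arcs α≤p)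

  -- What one direction of the picture yields. The reversed graph exchanges `(α, p)` with `(β, q)`
  -- and keeps `k`, but has its own `r′`, since its remainder set omits `x` instead of `y`.
  record Half (d N α p β q k r : ℕ) : Set where
    field
      source-large : d ≤ α + k + 1
      onward-large : 2 * d ≤ 2 * p + α + 2
      balance      : Small d α p r ⊎ Large d α p r
      partition    : α + p + β + q + k + r + 1 ≤ N

  module _ {d N α p β q k r r′ : ℕ}
    (H : Half d N α p β q k r) (H′ : Half d N β q α p k r′) (degree : 2 * N + 3 ≤ 7 * d) where
    private
      module H = Half H
      module H′ = Half H′

    -- Each case is a Farkas certificate: a nonnegative combination of the
    -- inequalities whose left side exceeds its right side.
    both-small : Small d α p r → Small d β q r′ → ⊥
    both-small s s′ = overshoot identity
      (2 ⊠ s ⊞ 2 ⊠ s′ ⊞ 2 ⊠ H.partition ⊞ 2 ⊠ H′.partition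
        ⊞ H.onward-large ⊞ H′.onward-large ⊞ H.source-large ⊞ H′.source-large ⊞ 2 ⊠ degree)
      where
      identity :
        2 * (2 * d + 1) + (2 * (2 * d + 1) +
        (2 * (α + p + β + q + k + r + 1) + (2 * (β + q + α + p + k + r′ + 1) +
        (2 * d + (2 * d + (d + (d + 2 * (2 * N + 3))))))))
        ≡ 2 * (α + p + r) + (2 * (β + q + r′) + (2 * N + (2 * N +
          (2 * p + α + 2 + (2 * q + β + 2 + (α + k + 1 + (β + k + 1 + 2 * (7 * d))))))))
          + suc (2 * k + 7)
      identity = solve (d ∷ N ∷ α ∷ p ∷ β ∷ q ∷ k ∷ r ∷ r′ ∷ [])

    both-large : Large d α p r → Large d β q r′ → ⊥
    both-large l l′ = overshoot identity
      (2 ⊠ l ⊞ 2 ⊠ l′ ⊞ 4 ⊠ H.partition ⊞ 4 ⊠ H′.partition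
        ⊞ H.onward-large ⊞ H′.onward-large
        ⊞ 4 ⊠ H.source-large ⊞ 4 ⊠ H′.source-large ⊞ 4 ⊠ degree)
      where
      identity :
        2 * (4 * d) + (2 * (4 * d) +
        (4 * (α + p + β + q + k + r + 1) + (4 * (β + q + α + p + k + r′ + 1) +
        (2 * d + (2 * d + (4 * d + (4 * d + 4 * (2 * N + 3))))))))
        ≡ 2 * (3 * p + 2 * r + α + 1) + (2 * (3 * q + 2 * r′ + β + 1) + (4 * N + (4 * N +
          (2 * p + α + 2 + (2 * q + β + 2 +
          (4 * (α + k + 1) + (4 * (β + k + 1) + 4 * (7 * d))))))))
          + suc (α + β + 3)
      identity = solve (d ∷ N ∷ α ∷ p ∷ β ∷ q ∷ k ∷ r ∷ r′ ∷ [])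

    small-large : Small d α p r → Large d β q r′ → ⊥
    small-large s l = overshoot identity
      (4 ⊠ s ⊞ 2 ⊠ l ⊞ 4 ⊠ H.partition ⊞ 4 ⊠ H′.partition
        ⊞ 2 ⊠ H.onward-large ⊞ H′.onward-large
        ⊞ 2 ⊠ H.source-large ⊞ 5 ⊠ H′.source-large ⊞ 4 ⊠ degree)
      where
      identity :
        4 * (2 * d + 1) + (2 * (4 * d) +
        (4 * (α + p + β + q + k + r + 1) + (4 * (β + q + α + p + k + r′ + 1) +
        (2 * (2 * d) + (2 * d + (2 * d + (5 * d + 4 * (2 * N + 3))))))))
        ≡ 4 * (α + p + r) + (2 * (3 * q + 2 * r′ + β + 1) + (4 * N + (4 * N +
          (2 * (2 * p + α + 2) + (2 * q + β + 2 +
          (2 * (α + k + 1) + (5 * (β + k + 1) + 4 * (7 * d))))))))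
          + suc (d + k + 8)
      identity = solve (d ∷ N ∷ α ∷ p ∷ β ∷ q ∷ k ∷ r ∷ r′ ∷ [])

  halves-incompatible : ∀ {d N α p β q k r r′} →
    Half d N α p β q k r → Half d N β q α p k r′ → ¬ 2 * N + 3 ≤ 7 * d
  halves-incompatible {d} {N} {α} {p} {β} {q} {k} {r} {r′} H H′ degree =
    [ (λ s → [ both-small H H′ degree s , small-large H H′ degree s ] H′.balance)
    , (λ l → [ (λ s → small-large H′ H degree s l) , both-large H H′ degree l ] H′.balance)
    ] H.balance
    where
    module H  = Half H
    module H′ = Half H′

-- The neighbourhoods of `x` and `y` when no short path exists

module Configuration where
  open Nat using (_+_)
  open Counting
  open Arithmetic

  -- A self-dual form of the negated conclusion, so that each fact proved once also holds for
  -- `reverse`. With `x ≢ y` and asymmetry, the side conditions of `no-3-path`, `no-4-path` and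
  -- `no-5-path` make the walks simple.
  record Obstruction (N d : ℕ) : Set₁ where
    field
      E    : Rel.Rel (Fin N) 0ℓ
      E?   : Rel.Decidable E
      asym : Rel.Asymmetric E
      out≥ : ∀ v → d ≤ # (λ w → E? v w)
      in≥  : ∀ v → d ≤ # (λ w → E? w v)
      x y a b : Fin N
      x→a : E x a
      a≢y : a ≢ y
      b→y : E b y
      b≢x : b ≢ x
      a≢b : a ≢ b
      no-3-path : ∀ {u v} → E x u → E u v → E v y → u ≢ y → v ≢ x → ⊥
      no-4-path : ∀ {u c v} → E x u → E u c → E c v → E v y → u ≢ y → v ≢ x → ⊥
      no-5-path : ∀ {u c c′ v} → E x u → E u c → E c c′ → E c′ v → E v y →
        u ≢ y → c ≢ y → c′ ≢ x → v ≢ x → u ≢ v → ⊥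

    irrefl : ∀ {v} → ¬ E v v
    irrefl e = asym e e

  module _ {N d : ℕ} where

    reverse : Obstruction N d → Obstruction N d
    reverse O = record
      { E = flip E ; E? = flip E? ; asym = asym ; out≥ = in≥ ; in≥ = out≥
      ; x = y ; y = x ; a = b ; b = a
      ; x→a = b→y ; a≢y = b≢x ; b→y = x→a ; b≢x = a≢y ; a≢b = a≢b ∘ sym
      ; no-3-path = λ p q r s t → no-3-path r q p t s
      ; no-4-path = λ p q r s t u → no-4-path s r q p u t
      ; no-5-path = λ p q r s t i j k l m → no-5-path t s r q p l k j i (m ∘ sym)
      }
      where open Obstruction O

    -- The sets are built in layers: `P` depends on `B`, which is `A` of the reversed graph, and `U`
    -- depends on `Q`, which is its `P`. Each layer opens the previous one for both `O` and
    -- `reverse O`.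
    module Source (O : Obstruction N d) where
      open Obstruction O

      A : Pred (Fin N) 0ℓ
      A v = E x v × v ≢ y

      A? : Decidable A
      A? v = E? x v ×-dec ¬? (v ≟ y)

    module Onward (O : Obstruction N d) where
      open Obstruction O
      open Source O public
      open Source (reverse O) public renaming (A to B; A? to B?)

      -- The arcs u → c → c′ → v with u in Gate and v in the reversed graph's
      -- Gate always extend to a path, since the two gates are disjoint.
      Gate : Pred (Fin N) 0ℓ
      Gate u = A u × (¬ B u ⊎ u ≡ a)

      Gate? : Decidable Gate
      Gate? u = A? u ×-dec (¬? (B? u) ⊎-dec (u ≟ a))

      P : Pred (Fin N) 0ℓ
      P c = ¬ A c × c ≢ y × ∃[ u ] Gate u × E u c

      P? : Decidable P
      P? c = ¬? (A? c) ×-dec ¬? (c ≟ y) ×-dec any? (λ u → Gate? u ×-dec E? u c)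

      A∖B? : Decidable (A ∩ ∁ B)
      A∖B? = A? ∩? ∁? B?

      I? : Decidable (A ∩ B)
      I? = A? ∩? B?

    module Rest (O : Obstruction N d) where
      open Obstruction O
      open Onward O public
      open Onward (reverse O) public
        using () renaming (P to Q; P? to Q?; Gate to Gate′; A∖B? to B∖A?; I? to I′?)

      W : Pred (Fin N) 0ℓ
      W = A ∪ B ∪ P ∪ Q

      U : Pred (Fin N) 0ℓ
      U v = ¬ W v × v ≢ y

      U? : Decidable U
      U? v = ¬? ((A? ∪? B? ∪? P? ∪? Q?) v) ×-dec ¬? (v ≟ y)

      α p k r : ℕ
      α = # A∖B?
      p = # P?
      k = # I?
      r = # U?

      -- A common vertex lies in both `A` and `B`, so it could enter the first gate only as `a` and
      -- the second only as `b`.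
      gates-disjoint : ∀ {u v} → Gate u → Gate′ v → u ≢ v
      gates-disjoint ((x→u , u≢y) , inj₁ ¬Bu) ((v→y , v≢x) , _) refl = ¬Bu (v→y , v≢x)
      gates-disjoint (Au , inj₂ refl) (_ , inj₁ ¬Av) refl = ¬Av Au
      gates-disjoint (_ , inj₂ refl) (_ , inj₂ a≡b) refl = a≢b a≡b

      -- Such an arc would complete a path of length 3. In the same way an arc from `P` to `B` would
      -- complete length 4, and one from `P` to `Q` length 5.
      A→B : ∀ {u v} → A u → E u v → ¬ B v
      A→B (x→u , u≢y) u→v (v→y , v≢x) = no-3-path x→u u→v v→y u≢y v≢x

      P→B : ∀ {c v} → P c → E c v → ¬ B v
      P→B (_ , _ , u , ((x→u , u≢y) , _) , u→c) c→v (v→y , v≢x) =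
        no-4-path x→u u→c c→v v→y u≢y v≢x

      P∩B : ∀ {c} → P c → ¬ B c
      P∩B (_ , _ , u , (Au , _) , u→c) Bc = A→B Au u→c Bc

      P∩Q : ∀ {c} → P c → ¬ Q c
      P∩Q Pc (_ , _ , v , (Bv , _) , c→v) = P→B Pc c→v Bv

      P→Q : ∀ {c c′} → P c → E c c′ → ¬ Q c′
      P→Q (_ , c≢y , u , Gu@((x→u , u≢y) , _) , u→c) c→c′
          (_ , c′≢x , v , Gv@((v→y , v≢x) , _) , c′→v) =
        no-5-path x→u u→c c→c′ c′→v v→y u≢y c≢y c′≢x v≢x (gates-disjoint Gu Gv)

      A∖B→ : ∀ {v w} → (A ∩ ∁ B) v → E v w → (A ∩ ∁ B) w ⊎ P w
      A∖B→ {v} {w} (Av , ¬Bv) v→w with A? w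
      ... | yes Aw = inj₁ (Aw , A→B Av v→w)
      ... | no ¬Aw = inj₂ (¬Aw , w≢y , v , (Av , inj₁ ¬Bv) , v→w)
        where
        w≢y : w ≢ y
        -- If `w` were `y`, the arc `v → y` would put `v` in `B`; here `v` differs from `x` because
        -- `x → v`.
        w≢y refl = ¬Bv (v→w , λ { refl → irrefl (proj₁ Av) })

      X? : Decidable ((A ∩ ∁ B) ∪ P)
      X? = A∖B? ∪? P?

      X→ : ∀ {v w} → ((A ∩ ∁ B) ∪ P) v → E v w → ((A ∩ ∁ B) ∪ P) w ⊎ P v × U w
      X→ (inj₁ v∈A∖B) v→w = inj₁ (A∖B→ v∈A∖B v→w)
      X→ {v} {w} (inj₂ Pv@(_ , _ , u , ((x→u , _) , _) , u→v)) v→w with A? w | P? w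
      ... | yes Aw | _      = inj₁ (inj₁ (Aw , P→B Pv v→w))
      ... | no _   | yes Pw = inj₁ (inj₂ Pw)
      ... | no ¬Aw | no ¬Pw = inj₂ (Pv , ¬W , w≢y)
        where
        ¬W : ¬ W w
        ¬W (inj₁ Aw) = ¬Aw Aw
        ¬W (inj₂ (inj₁ Bw)) = P→B Pv v→w Bw
        ¬W (inj₂ (inj₂ (inj₁ Pw))) = ¬Pw Pw
        ¬W (inj₂ (inj₂ (inj₂ Qw))) = P→Q Pv v→w Qw
        w≢y : w ≢ y
        -- An arc `v → y` would put `v` in `B`, unless `v` is `x`; but then `u → v` is opposite to
        -- `x → u`.
        w≢y refl = P∩B Pv (v→w , λ { refl → asym x→u u→v })

      |X| : # X? ≡ α + p
      |X| = ≤-antisym (#-∪-≤ A∖B? P?) (#-disjoint A∖B? P? λ { (Av , _) (¬Av , _) → ¬Av Av })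

      |A| : # A? ≤ α + k
      |A| = ≤-trans (#-mono A? (A∖B? ∪? I?) split) (#-∪-≤ A∖B? I?)
        where
        split : ∀ {v} → A v → ((A ∩ ∁ B) ∪ (A ∩ B)) v
        split {v} Av with B? v
        ... | yes Bv = inj₂ (Av , Bv)
        ... | no ¬Bv = inj₁ (Av , ¬Bv)

      -- The 1 accounts for `y`, which may be an out-neighbour of `x` but is excluded from `A`.
      source-large : d ≤ α + k + 1
      source-large = begin
        d                     ≤⟨ out≥ x ⟩
        # (E? x)              ≤⟨ #-mono (E? x) (A? ∪? (_≟ y)) split ⟩
        # (A? ∪? (_≟ y))      ≤⟨ #-∪-≤ A? (_≟ y) ⟩
        # A? + # (_≟ y)       ≤⟨ +-mono-≤ |A| (≤-reflexive (#-singleton y)) ⟩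
        α + k + 1             ∎
        where
        open ≤-Reasoning
        split : ∀ {v} → E x v → (A ∪ (_≡ y)) v
        split {v} x→v with v ≟ y
        ... | yes v≡y = inj₂ v≡y
        ... | no v≢y  = inj₁ (x→v , v≢y)

      -- If `A ∖ B` is inhabited, the count of arcs leaving it, all of which end in `P`, can be
      -- divided by `α`. Otherwise the out-neighbours of `a` lie in `P` or equal `y`, because `a`
      -- belongs to `Gate` even when it is in `B`; doubling the contribution of `y` gives the 2.
      onward-large : 2 * d ≤ 2 * p + α + 2
      onward-large with any? A∖B?
      ... | yes (v , v∈A∖B) = ≤-trans (≤-trans (m≤m+n (2 * d) 1) (*-cancelʳ-≤ _ _ α {{α≢0}} scaled))
        (m≤m+n _ 2)
        where
        open ≤-Reasoning
        α≢0 : NonZero α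
        α≢0 = Nat.>-nonZero (≤-trans (≤-reflexive (sym (#-singleton v)))
          (#-mono (_≟ v) A∖B? λ { refl → v∈A∖B }))
        scaled : (2 * d + 1) * α ≤ (2 * p + α) * α
        scaled = begin
          (2 * d + 1) * α           ≡⟨ expand d α ⟩
          2 * (d * α) + α           ≤⟨ arcs-leaving E? asym A∖B? A∖B? P? leave d out≥ ⟩
          α * α + 2 * (α * p)       ≡⟨ collect p α ⟩
          (2 * p + α) * α           ∎
          where
          leave : ∀ {v w} → (A ∩ ∁ B) v → E v w → (A ∩ ∁ B) w ⊎ (A ∩ ∁ B) v × P w
          leave v∈ v→w = Sum.map₂ (v∈ ,_) (A∖B→ v∈ v→w)
          expand : ∀ d α → (2 * d + 1) * α ≡ 2 * (d * α) + α
          expand = solve-∀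
          collect : ∀ p α → α * α + 2 * (α * p) ≡ (2 * p + α) * α
          collect = solve-∀
      ... | no A∖B-empty = begin
        2 * d                     ≤⟨ *-monoʳ-≤ 2 (out≥ a) ⟩
        2 * # (E? a)              ≤⟨ *-monoʳ-≤ 2 (#-mono (E? a) (P? ∪? (_≟ y)) land) ⟩
        2 * # (P? ∪? (_≟ y))      ≤⟨ *-monoʳ-≤ 2 (#-∪-≤ P? (_≟ y)) ⟩
        2 * (p + # (_≟ y))        ≡⟨ cong (λ z → 2 * (p + z)) (#-singleton y) ⟩
        2 * (p + 1)               ≡⟨ *-distribˡ-+ 2 p 1 ⟩
        2 * p + 2                 ≤⟨ +-monoˡ-≤ 2 (m≤m+n (2 * p) α) ⟩
        2 * p + α + 2             ∎
        where
        open ≤-Reasoning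
        land : ∀ {w} → E a w → (P ∪ (_≡ y)) w
        land {w} a→w with w ≟ y | A? w | B? w
        ... | yes w≡y | _      | _      = inj₂ w≡y
        ... | no _    | yes _  | yes Bw = ⊥-elim (A→B (x→a , a≢y) a→w Bw)
        ... | no _    | yes Aw | no ¬Bw = ⊥-elim (A∖B-empty (w , Aw , ¬Bw))
        ... | no w≢y  | no ¬Aw | _      = inj₁ (¬Aw , w≢y , a , ((x→a , a≢y) , inj₂ refl) , a→w)

      -- By `X→`, arcs that leave `X` start in `P` and end in `U`, whence the product `p * r`.
      balance : 3 ≤ d → Small d α p r ⊎ Large d α p r
      balance d≥3 = dichotomy {d} {α} {p} {r} d≥3 onward-large
        (subst (λ u → 2 * (d * u) + u ≤ u * u + 2 * (p * r)) |X|
          (arcs-leaving E? asym X? P? U? X→ d out≥))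

      partition : α + p + # B∖A? + # Q? + k + r + 1 ≤ N
      partition = begin
        α + p + # B∖A? + # Q? + k + r + 1
          ≡⟨ cong (α + p + # B∖A? + # Q? + k + r +_) (sym (#-singleton y)) ⟩
        α + p + # B∖A? + # Q? + k + r + # (_≟ y)
          ≤⟨ +-monoˡ-≤ _ (+-monoˡ-≤ r (+-monoˡ-≤ k (+-monoˡ-≤ _
               (≤-trans (+-monoˡ-≤ _ (≤-reflexive (sym |X|))) (#-disjoint X? B∖A? d₁))))) ⟩
        # (X? ∪? B∖A?) + # Q? + k + r + # (_≟ y)
          ≤⟨ +-monoˡ-≤ _ (+-monoˡ-≤ r (+-monoˡ-≤ k (#-disjoint (X? ∪? B∖A?) Q? d₂))) ⟩
        # ((X? ∪? B∖A?) ∪? Q?) + k + r + # (_≟ y)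
          ≤⟨ +-monoˡ-≤ _ (+-monoˡ-≤ r (#-disjoint ((X? ∪? B∖A?) ∪? Q?) I? d₃)) ⟩
        # (((X? ∪? B∖A?) ∪? Q?) ∪? I?) + r + # (_≟ y)
          ≤⟨ +-monoˡ-≤ _ (#-disjoint (((X? ∪? B∖A?) ∪? Q?) ∪? I?) U? d₄) ⟩
        # ((((X? ∪? B∖A?) ∪? Q?) ∪? I?) ∪? U?) + # (_≟ y)
          ≤⟨ #-disjoint ((((X? ∪? B∖A?) ∪? Q?) ∪? I?) ∪? U?) (_≟ y) d₅ ⟩
        # (((((X? ∪? B∖A?) ∪? Q?) ∪? I?) ∪? U?) ∪? (_≟ y))
          ≤⟨ #≤n (((((X? ∪? B∖A?) ∪? Q?) ∪? I?) ∪? U?) ∪? (_≟ y)) ⟩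
        N ∎
        where
        open ≤-Reasoning
        X B∖A : Pred (Fin N) 0ℓ
        X   = (A ∩ ∁ B) ∪ P
        B∖A = B ∩ ∁ A

        A∩Q : ∀ {v} → A v → ¬ Q v
        A∩Q Av (_ , _ , v , (Bv , _) , u→v) = A→B Av u→v Bv

        d₁ : ∀ {v} → X v → B∖A v → ⊥
        d₁ (inj₁ (Av , _)) (_ , ¬Av) = ¬Av Av
        d₁ (inj₂ Pv)       (Bv , _)  = P∩B Pv Bv

        d₂ : ∀ {v} → (X ∪ B∖A) v → Q v → ⊥
        d₂ (inj₁ (inj₁ (Av , _))) Qv        = A∩Q Av Qv
        d₂ (inj₁ (inj₂ Pv))       Qv        = P∩Q Pv Qv
        d₂ (inj₂ (Bv , _))        (¬Bv , _) = ¬Bv Bv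

        d₃ : ∀ {v} → ((X ∪ B∖A) ∪ Q) v → (A ∩ B) v → ⊥
        d₃ (inj₁ (inj₁ (inj₁ (_ , ¬Bv)))) (_ , Bv) = ¬Bv Bv
        d₃ (inj₁ (inj₁ (inj₂ (¬Av , _)))) (Av , _) = ¬Av Av
        d₃ (inj₁ (inj₂ (_ , ¬Av)))        (Av , _) = ¬Av Av
        d₃ (inj₂ (¬Bv , _))               (_ , Bv) = ¬Bv Bv

        in-W : ∀ {v} → (((X ∪ B∖A) ∪ Q) ∪ (A ∩ B)) v → W v
        in-W (inj₁ (inj₁ (inj₁ (inj₁ (Av , _))))) = inj₁ Av
        in-W (inj₁ (inj₁ (inj₁ (inj₂ Pv))))       = inj₂ (inj₂ (inj₁ Pv))
        in-W (inj₁ (inj₁ (inj₂ (Bv , _))))        = inj₂ (inj₁ Bv)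
        in-W (inj₁ (inj₂ Qv))                     = inj₂ (inj₂ (inj₂ Qv))
        in-W (inj₂ (Av , _))                      = inj₁ Av

        d₄ : ∀ {v} → (((X ∪ B∖A) ∪ Q) ∪ (A ∩ B)) v → U v → ⊥
        d₄ v∈ (¬Wv , _) = ¬Wv (in-W v∈)

        -- `A` and `P` exclude `y` by definition; membership in `B` would be a loop, and membership
        -- in `Q` would give an arc opposite to some `v → y`. So `y` is the 1 in `partition`.
        y∉W : ¬ W y
        y∉W (inj₁ (_ , y≢y))               = y≢y refl
        y∉W (inj₂ (inj₁ (y→y , _)))        = irrefl y→y
        y∉W (inj₂ (inj₂ (inj₁ (_ , y≢y , _)))) = y≢y refl
        y∉W (inj₂ (inj₂ (inj₂ (_ , _ , v , ((v→y , _) , _) , y→v)))) = asym v→y y→v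

        d₅ : ∀ {v} → ((((X ∪ B∖A) ∪ Q) ∪ (A ∩ B)) ∪ U) v → v ≡ y → ⊥
        d₅ (inj₁ v∈)       refl = y∉W (in-W v∈)
        d₅ (inj₂ (_ , y≢y)) refl = y≢y refl

      half : 3 ≤ d → Half d N α p (# B∖A?) (# Q?) k r
      half d≥3 = record
        { source-large = source-large
        ; onward-large = onward-large
        ; balance      = balance d≥3
        ; partition    = partition
        }

    impossible : Obstruction N d → 3 ≤ d → ¬ 2 * N + 3 ≤ 7 * d
    impossible O d≥3 = halves-incompatible (half d≥3)
      -- The reversed graph counts `B ∩ A` where `k` counts `A ∩ B`.
      (subst (λ k → Half d N (# B∖A?) (# Q?) α p k (Rest.r (reverse O))) k′≡k (Rest.half (reverse O) d≥3))
      where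
      open Rest O
      k′≡k : # I′? ≡ k
      k′≡k = ≤-antisym (#-mono I′? I? swap) (#-mono I? I′? swap)

-- Simple paths from arcs with side conditions

module Paths {N : ℕ} (H : OrientedGraph N) (x y : Fin N) (x≢y : x ≢ y) where
  open OrientedGraph H
  open import Data.Vec.Base using ([]; _∷_)
  open import Data.Vec.Relation.Unary.All using ([]; _∷_)
  open import Data.Vec.Relation.Unary.AllPairs.Core using ([]; _∷_)
  open import Data.Vec.Relation.Unary.Linked using ([-]; _∷_)

  private
    infixr 4 _+→_

    -- Equal ends would make the two arcs opposite. Together with `→≢`, `x≢y` and the side
    -- conditions of a route, this accounts for every pair in `simple`.
    _+→_ : ∀ {u v w} → Arc u v → Arc v w → u ≢ w
    (u→v +→ v→u) refl = asym u→v v→u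

    →≢ : ∀ {u v} → Arc u v → u ≢ v
    →≢ u→v u≡v = irrefl u≡v u→v

  Route₃ : Fin N → Fin N → Set
  Route₃ u v = Arc x u × Arc u v × Arc v y × u ≢ y × v ≢ x

  Route₄ : Fin N → Fin N → Fin N → Set
  Route₄ u c v = Arc x u × Arc u c × Arc c v × Arc v y × u ≢ y × v ≢ x

  Route₅ : Fin N → Fin N → Fin N → Fin N → Set
  Route₅ u c c′ v = Arc x u × Arc u c × Arc c c′ × Arc c′ v × Arc v y ×
    u ≢ y × c ≢ y × c′ ≢ x × v ≢ x × u ≢ v

  -- Exhaustive search keeps the argument by contradiction constructive: either a route is found, or
  -- its absence feeds the obstruction.
  route₃? : Dec (∃[ u ] ∃[ v ] Route₃ u v)
  route₃? = any? λ u → any? λ v →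
    arc? x u ×-dec arc? u v ×-dec arc? v y ×-dec ¬? (u ≟ y) ×-dec ¬? (v ≟ x)

  route₄? : Dec (∃[ u ] ∃[ c ] ∃[ v ] Route₄ u c v)
  route₄? = any? λ u → any? λ c → any? λ v →
    arc? x u ×-dec arc? u c ×-dec arc? c v ×-dec arc? v y ×-dec ¬? (u ≟ y) ×-dec ¬? (v ≟ x)

  route₅? : Dec (∃[ u ] ∃[ c ] ∃[ c′ ] ∃[ v ] Route₅ u c c′ v)
  route₅? = any? λ u → any? λ c → any? λ c′ → any? λ v →
    arc? x u ×-dec arc? u c ×-dec arc? c c′ ×-dec arc? c′ v ×-dec arc? v y ×-dec
    ¬? (u ≟ y) ×-dec ¬? (c ≟ y) ×-dec ¬? (c′ ≟ x) ×-dec ¬? (v ≟ x) ×-dec ¬? (u ≟ v)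

  path₃ : ∀ {u v} → Route₃ u v → Path H x y 3
  path₃ {u} {v} (x→u , u→v , v→y , u≢y , v≢x) = record
    { vertices = x ∷ u ∷ v ∷ y ∷ []
    ; starts   = refl
    ; ends     = refl
    ; arcs     = x→u ∷ u→v ∷ v→y ∷ [-]
    ; simple   = (→≢ x→u ∷ v≢x ∘ sym ∷ x≢y ∷ [])
               ∷ (→≢ u→v ∷ u≢y ∷ [])
               ∷ (→≢ v→y ∷ [])
               ∷ [] ∷ []
    }

  path₄ : ∀ {u c v} → Route₄ u c v → Path H x y 4
  path₄ {u} {c} {v} (x→u , u→c , c→v , v→y , u≢y , v≢x) = record
    { vertices = x ∷ u ∷ c ∷ v ∷ y ∷ []
    ; starts   = refl
    ; ends     = refl
    ; arcs     = x→u ∷ u→c ∷ c→v ∷ v→y ∷ [-]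
    ; simple   = (→≢ x→u ∷ (x→u +→ u→c) ∷ v≢x ∘ sym ∷ x≢y ∷ [])
               ∷ (→≢ u→c ∷ (u→c +→ c→v) ∷ u≢y ∷ [])
               ∷ (→≢ c→v ∷ (c→v +→ v→y) ∷ [])
               ∷ (→≢ v→y ∷ [])
               ∷ [] ∷ []
    }

  path₅ : ∀ {u c c′ v} → Route₅ u c c′ v → Path H x y 5
  path₅ {u} {c} {c′} {v} (x→u , u→c , c→c′ , c′→v , v→y , u≢y , c≢y , c′≢x , v≢x , u≢v) = record
    { vertices = x ∷ u ∷ c ∷ c′ ∷ v ∷ y ∷ []
    ; starts   = refl
    ; ends     = refl
    ; arcs     = x→u ∷ u→c ∷ c→c′ ∷ c′→v ∷ v→y ∷ [-]
    ; simple   = (→≢ x→u ∷ (x→u +→ u→c) ∷ c′≢x ∘ sym ∷ v≢x ∘ sym ∷ x≢y ∷ [])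
               ∷ (→≢ u→c ∷ (u→c +→ c→c′) ∷ u≢v ∷ u≢y ∷ [])
               ∷ (→≢ c→c′ ∷ (c→c′ +→ c′→v) ∷ c≢y ∷ [])
               ∷ (→≢ c′→v ∷ (c′→v +→ v→y) ∷ [])
               ∷ (→≢ v→y ∷ [])
               ∷ [] ∷ []
    }

-- Minimum semidegree and existence of a short path

module Degree where
  open Nat using (_+_)
  open Counting
  open Configuration

  private variable
    n N : ℕ

  ∣tabulate∣ : {P : Pred (Fin n) 0ℓ} (P? : Decidable P) → ∣ tabulate (does ∘ P?) ∣ ≡ # P?
  ∣tabulate∣ {zero}  P? = refl
  ∣tabulate∣ {suc n} P? with does (P? zero)
  ... | true  = cong suc (∣tabulate∣ (P? ∘ suc))
  ... | false = ∣tabulate∣ (P? ∘ suc)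

  foldr-⊓-≤ : ∀ z (f : Fin n → ℕ) i → Vector.foldr _⊓_ z f ≤ f i
  foldr-⊓-≤ z f zero    = m⊓n≤m _ _
  foldr-⊓-≤ z f (suc i) = ≤-trans (m⊓n≤n _ _) (foldr-⊓-≤ z (f ∘ suc) i)

  module _ (H : OrientedGraph N) where
    open OrientedGraph H

    δ⁰≤out : ∀ v → δ⁰ H ≤ # (arc? v)
    δ⁰≤out v = ≤-trans (foldr-⊓-≤ N _ v)
      (≤-trans (m⊓n≤m _ _) (≤-reflexive (∣tabulate∣ (arc? v))))

    δ⁰≤in : ∀ v → δ⁰ H ≤ # (flip arc? v)
    δ⁰≤in v = ≤-trans (foldr-⊓-≤ N _ v)
      (≤-trans (m⊓n≤n _ _) (≤-reflexive (∣tabulate∣ (flip arc? v))))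

    short-path : 3 ≤ δ⁰ H → 2 * N + 3 ≤ 7 * δ⁰ H → ∀ x y → x ≢ y →
      Path H x y 3 ⊎ Path H x y 4 ⊎ Path H x y 5
    short-path δ⁰≥3 degree x y x≢y = search route₃? route₄? route₅?
      where
      open Paths H x y x≢y
      search : Dec _ → Dec _ → Dec _ → _
      search (yes (_ , _ , route)) _ _ = inj₁ (path₃ route)
      search (no _) (yes (_ , _ , _ , route)) _ = inj₂ (inj₁ (path₄ route))
      search (no _) (no _) (yes (_ , _ , _ , _ , route)) = inj₂ (inj₂ (path₅ route))
      search (no ¬₃) (no ¬₄) (no ¬₅)
        -- For `a` only `y` is to be avoided, so it fills both slots. Since `b` must avoid both `x`
        -- and `a`, three in-neighbours of `y` are required.
        with a , x→a , a≢y , _ ← #-avoid (arc? x) (≤-trans δ⁰≥3 (δ⁰≤out x)) y y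
        with b , b→y , b≢x , b≢a ← #-avoid (flip arc? y) (≤-trans δ⁰≥3 (δ⁰≤in y)) x a
        = ⊥-elim (impossible obstruction δ⁰≥3 degree)
        where
        obstruction : Obstruction N (δ⁰ H)
        obstruction = record
          { E = Arc ; E? = arc? ; asym = asym ; out≥ = δ⁰≤out ; in≥ = δ⁰≤in
          ; x = x ; y = y ; a = a ; b = b
          ; x→a = x→a ; a≢y = a≢y ; b→y = b→y ; b≢x = b≢x ; a≢b = b≢a ∘ sym
          ; no-3-path = λ p q r i j → ¬₃ (_ , _ , p , q , r , i , j)
          ; no-4-path = λ p q r s i j → ¬₄ (_ , _ , _ , p , q , r , s , i , j)
          ; no-5-path = λ p q r s t i j k l m →
              ¬₅ (_ , _ , _ , _ , p , q , r , s , t , i , j , k , l , m)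
          }

-- Elimination of `C` and of the rational bound

module Reduction where
  open Nat using (_+_)

  -- Seven times the semidegree bound carries `21 * C`, which the order bound replaces by `N + 12`;
  -- the result is divisible by 3.
  degree-bound : ∀ C N δ → 21 * C ∸ 12 ≤ N → N + 3 ≤ 3 * δ + 3 * C → 2 * N + 3 ≤ 7 * δ
  degree-bound C N δ order semidegree = *-cancelˡ-≤ 3 (+-cancelʳ-≤ (N + 12 + 21 * C) _ _ (begin
    3 * (2 * N + 3) + (N + 12 + 21 * C)   ≡⟨ left N C ⟩
    7 * (N + 3) + 21 * C                  ≤⟨ +-mono-≤ (*-monoʳ-≤ 7 semidegree) 21C≤N+12 ⟩
    7 * (3 * δ + 3 * C) + (N + 12)        ≡⟨ right δ N C ⟩
    3 * (7 * δ) + (N + 12 + 21 * C)       ∎))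
    where
    open ≤-Reasoning
    left : ∀ N C → 3 * (2 * N + 3) + (N + 12 + 21 * C) ≡ 7 * (N + 3) + 21 * C
    left = solve-∀
    right : ∀ δ N C → 7 * (3 * δ + 3 * C) + (N + 12) ≡ 3 * (7 * δ) + (N + 12 + 21 * C)
    right = solve-∀
    21C≤N+12 : 21 * C ≤ N + 12
    -- Truncated subtraction does no harm here: `m ≤ n + (m ∸ n)` holds in all cases.
    21C≤N+12 = ≤-trans (m≤n+m∸n (21 * C) 12) (≤-trans (+-monoʳ-≤ 12 order) (≤-reflexive (+-comm 12 N)))

open import Data.Integer.Base using (+_)
open import Data.Rational.Unnormalised.Base as ℚᵘ using (_/_; _+_; _-_; 1ℚᵘ)

clear-denominators : ∀ C N δ → fromℕ δ ℚᵘ.≥ (+ N / 3) - fromℕ C + 1ℚᵘ →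
  N Nat.+ 3 ≤ 3 * δ Nat.+ 3 * C
clear-denominators C N δ (ℚᵘ.*≤* h) = ℤₚ.drop‿+≤+ (begin
  + (N Nat.+ 3)                                   ≡⟨ ℤₚ.pos-+ N 3 ⟩
  + N ℤ.+ + 3                                     ≡⟨ left (+ N) (+ C) ⟩
  -- The first summand is the left side of `h` as unnormalised arithmetic computes it: the numerator
  -- over denominator 3, times the denominator 1 of `fromℕ δ`.
  ((+ N ℤ.* + 1 ℤ.+ ℤ.- (+ C) ℤ.* + 3) ℤ.* + 1 ℤ.+ + 1 ℤ.* + 3) ℤ.* + 1 ℤ.+ + 3 ℤ.* + C
                                                  ≤⟨ ℤₚ.+-monoˡ-≤ (+ 3 ℤ.* + C) h ⟩
  + δ ℤ.* + 3 ℤ.+ + 3 ℤ.* + C                     ≡⟨ right (+ δ) (+ C) ⟩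
  + 3 ℤ.* + δ ℤ.+ + 3 ℤ.* + C                     ≡⟨ cong₂ ℤ._+_ (ℤₚ.pos-* 3 δ) (ℤₚ.pos-* 3 C) ⟨
  + (3 * δ) ℤ.+ + (3 * C)                         ≡⟨ ℤₚ.pos-+ (3 * δ) (3 * C) ⟨
  + (3 * δ Nat.+ 3 * C)                           ∎)
  where
  open ℤₚ.≤-Reasoning
  left : ∀ i j → i ℤ.+ + 3 ≡ ((i ℤ.* + 1 ℤ.+ ℤ.- j ℤ.* + 3) ℤ.* + 1 ℤ.+ + 1 ℤ.* + 3) ℤ.* + 1 ℤ.+ + 3 ℤ.* j
  left = ℤRing.solve-∀
  right : ∀ i j → i ℤ.* + 3 ℤ.+ + 3 ℤ.* j ≡ + 3 ℤ.* i ℤ.+ + 3 ℤ.* j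
  right = ℤRing.solve-∀

corollary2p3 : (C : ℕ) → 0 < C →
    (N : ℕ) → N ≥ 21 * C ∸ 12 →
    (H : OrientedGraph N) →
    fromℕ (δ⁰ H) ℚᵘ.≥ (+ N / 3) - fromℕ C + 1ℚᵘ →
    (x y : Fin N) → x ≢ y →
    Path H x y 3 ⊎ Path H x y 4 ⊎ Path H x y 5
corollary2p3 C C>0 N order H semidegree = Degree.short-path H δ⁰≥3 degree
  where
  degree : 2 * N Nat.+ 3 ≤ 7 * δ⁰ H
  degree = Reduction.degree-bound C N (δ⁰ H) order (clear-denominators C N (δ⁰ H) semidegree)

  -- Since `C ≥ 1`, the order is at least 21 - 12 = 9; then `7 * δ⁰ H` is at least 2 * 9 + 3 = 7 *
  -- 3.
  N≥9 : 9 ≤ N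
  N≥9 = ≤-trans (∸-monoˡ-≤ 12 (*-monoʳ-≤ 21 C>0)) order

  δ⁰≥3 : 3 ≤ δ⁰ H
  δ⁰≥3 = *-cancelˡ-≤ 7 (≤-trans (+-monoˡ-≤ 3 (*-monoʳ-≤ 2 N≥9)) degree)
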